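{- Let $f:\{0,1\}^n\to\{0,1\}$, $c\in\mathbb{R}^n_{\ge0}$ an unknown cost vector, $\beta>0$ and $\varepsilon\in(0,1]$. There is an online algorithm with unit investment $\beta$ ("follow the pruned tree") which, given $\varepsilon$ and a decision tree $T$ computing $f$, computes $f$ with error at most $\varepsilon$ and has expected cost at most $\beta n+\mathrm{opt}^{\mathrm{avg}}_0(f,c)\cdot\frac{\Delta(T)}{\varepsilon}$.
   Context: Online priced query model: input $x\in\{0,1\}^n$ and costs $c$ unknown; investments $\theta$ start at $0$, each step increases one $\theta_i$ by $\beta$; $x_i$ is revealed once $\theta_i\ge c_i$; cost is $\|\theta\|_1$ at halting. Error is $\Pr_x[\text{output}\ne f(x)]$ and expected cost is over uniform $x$ (and the algorithm's randomness). $\mathrm{opt}^{\mathrm{avg}}_0(f,c)$ is the infimum of expected cost over all zero-error algorithms (offline ones know $c$ and pay $c_i$ per revealed $x_i$). The average depth $\Delta(T)$ is $0$ if $T$ is a single node, and $1+\frac12(\Delta(T_0)+\Delta(T_1))$ if the root has subtrees $T_0,T_1$.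
   Formalization: The decision tree T is assumed to query no variable twice on a root-to-leaf path; with repeated queries the recursive Δ(T) is not the average depth, can be padded below 4 for every f, and the bound then fails. -}

module Defs where

open import Algebra.Bundles using (CommutativeRing)
import Algebra.Definitions.RawMonoid as RawMonoidDefinitions
open import Data.Bool.Base using (Bool; true; false; if_then_else_; _xor_)
open import Data.Fin.Base using (Fin; zero; suc)
open import Data.Fin.Subset using (Subset; ⁅_⁆; _∪_; ⊥)
open import Data.List.Base using (List; []; _∷_)
open import Data.Maybe.Base using (Maybe; just; nothing)
open import Data.Nat.Base using (ℕ; zero; suc)
open import Data.Product.Base using (∃; ∃-syntax; _×_; _,_)
open import Data.Unit.Base using (⊤)
open import Data.Vec.Base using (Vec; []; _∷_; lookup)
open import Data.Vec.Functional using (Vector; updateAt; replicate)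
open import Function.Base using (_∘_)
open import Level using (0ℓ)
open import Relation.Binary.Core using (Rel)
open import Relation.Binary.Structures using (IsDecTotalOrder)
import Relation.Binary.Construct.NonStrictToStrict as NonStrictToStrict
open import Relation.Binary.PropositionalEquality.Core using (_≡_; _≢_)
open import Relation.Nullary.Decidable.Core using (does)
open import Relation.Unary using (Pred)

-- The real numbers, axiomatised as a Dedekind-complete ordered field (unique
-- up to isomorphism).  The axioms have their classical reading: deciding the
-- order, `archimedean` with a witness, and total `inf` all hold of the reals
-- once excluded middle is available in the metatheory.  As usual `_⁻¹` is
-- unconstrained at 0, and `inf` outside nonempty sets bounded below.
record RealNumbers : Set₁ where
  infix 4 _≤_
  infix 9 _⁻¹
  field
    commutativeRing : CommutativeRing 0ℓ 0ℓ

  open CommutativeRing commutativeRing public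
    using (Carrier; _≈_; _≉_; _+_; _*_; 0#; 1#; +-rawMonoid)
  open RawMonoidDefinitions +-rawMonoid public
    using (sum) renaming (_×_ to _·_)

  field
    _≤_             : Rel Carrier 0ℓ
    isDecTotalOrder : IsDecTotalOrder _≈_ _≤_

  open IsDecTotalOrder isDecTotalOrder public using (_≤?_)
  open NonStrictToStrict _≈_ _≤_ public using (_<_)

  IsLowerBound : Pred Carrier 0ℓ → Carrier → Set
  IsLowerBound P b = ∀ {y} → P y → b ≤ y

  field
    _⁻¹         : Carrier → Carrier
    inf         : Pred Carrier 0ℓ → Carrier
    1≉0         : 1# ≉ 0#
    *-inverseʳ  : ∀ {x} → x ≉ 0# → x * x ⁻¹ ≈ 1#
    +-monoʳ-≤   : ∀ z {x y} → x ≤ y → z + x ≤ z + y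
    *-nonNeg    : ∀ {x y} → 0# ≤ x → 0# ≤ y → 0# ≤ x * y
    archimedean : ∀ x {y} → 0# < y → ∃[ k ] x ≤ k · y
    inf-lower    : ∀ P → ∃ P → ∃ (IsLowerBound P) → IsLowerBound P (inf P)
    inf-greatest : ∀ P → ∃ P → ∃ (IsLowerBound P) →
                   ∀ {b} → IsLowerBound P b → b ≤ inf P

  ½ : Carrier
  ½ = (1# + 1#) ⁻¹

data DecisionTree (n : ℕ) : Set where
  leaf : Bool → DecisionTree n
  node : Fin n → (T₀ T₁ : DecisionTree n) → DecisionTree n

eval : ∀ {n} → DecisionTree n → Vec Bool n → Bool
eval (leaf b)       x = b
eval (node i T₀ T₁) x = if lookup x i then eval T₁ x else eval T₀ x

Computes : ∀ {n} → DecisionTree n → (Vec Bool n → Bool) → Set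
Computes T f = ∀ x → eval T x ≡ f x

queried : ∀ {n} → DecisionTree n → Vec Bool n → Subset n
queried (leaf b)       x = ⊥
queried (node i T₀ T₁) x =
  ⁅ i ⁆ ∪ (if lookup x i then queried T₁ x else queried T₀ x)

Absent : ∀ {n} → Fin n → DecisionTree n → Set
Absent i (leaf b)       = ⊤
Absent i (node j T₀ T₁) = i ≢ j × Absent i T₀ × Absent i T₁

-- No variable is queried twice on a root-to-leaf path.  Only for such trees
-- is the recursively defined average depth Δ the expected number of queries
-- on a uniform input.
ReadOnce : ∀ {n} → DecisionTree n → Set
ReadOnce (leaf b)       = ⊤
ReadOnce (node i T₀ T₁) = Absent i T₀ × Absent i T₁ × ReadOnce T₀ × ReadOnce T₁

data Action (n : ℕ) : Set where
  invest : Fin n → Action n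
  output : Bool → Action n

module PricedQuery (ℝ : RealNumbers) where
  open RealNumbers ℝ

  Δ : ∀ {n} → DecisionTree n → Carrier
  Δ (leaf b)       = 0#
  Δ (node i T₀ T₁) = 1# + ½ * (Δ T₀ + Δ T₁)

  -- Expectation over a uniform input, i.e. over n independent fair bits.
  𝔼 : ∀ {n} → (Vec Bool n → Carrier) → Carrier
  𝔼 {zero}  g = g []
  𝔼 {suc n} g = ½ * (𝔼 (g ∘ (false ∷_)) + 𝔼 (g ∘ (true ∷_)))

  -- Indicator of b ≢ b′.
  mismatch : Bool → Bool → Carrier
  mismatch b b′ = if b xor b′ then 1# else 0#

  -- A randomised algorithm is a finitely supported probability distribution
  -- over deterministic algorithms.
  record Randomised (D : Set) : Set where
    field
      size     : ℕ
      weight   : Vector Carrier size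
      strategy : Vector D size
      nonNeg   : ∀ j → 0# ≤ weight j
      total    : sum weight ≈ 1#

    average : Vector Carrier size → Carrier
    average g = sum (λ j → weight j * g j)

  open Randomised

  -- Offline algorithms are decision trees; since the set of competing trees
  -- is considered for each fixed c, they may depend on c.  A repeated query
  -- reveals nothing new and is not charged again.
  module _ {n : ℕ} (B : Randomised (DecisionTree n)) where

    offlineError : (Vec Bool n → Bool) → Carrier
    offlineError f =
      average B λ j → 𝔼 λ x → mismatch (eval (strategy B j) x) (f x)

    offlineCost : Vector Carrier n → Carrier
    offlineCost c =
      average B λ j → 𝔼 λ x →
        sum λ i → if lookup (queried (strategy B j) x) i then c i else 0#

  ZeroErrorCost : ∀ {n} → (Vec Bool n → Bool) → Vector Carrier n → Pred Carrier 0ℓ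
  ZeroErrorCost f c v =
    ∃[ B ] offlineError B f ≈ 0# × offlineCost B c ≈ v

  opt : ∀ {n} → (Vec Bool n → Bool) → Vector Carrier n → Carrier
  opt f c = inf (ZeroErrorCost f c)

  record Snapshot (n : ℕ) : Set where
    constructor snapshot
    field
      invested : Vector Carrier n
      revealed : Vector (Maybe Bool) n

  -- A deterministic online algorithm sees the earlier snapshots (latest
  -- first) and the current one; the costs c are not part of its input.
  Online : ℕ → Set
  Online n = List (Snapshot n) → Snapshot n → Action n

  module _ {n : ℕ} (β : Carrier) (c : Vector Carrier n) (x : Vec Bool n) where

    observe : Vector Carrier n → Snapshot n
    observe θ = snapshot θ λ i →
      if does (c i ≤? θ i) then just (lookup x i) else nothing

    data Run (A : Online n) (h : List (Snapshot n)) (θ : Vector Carrier n) : Set where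
      halt : ∀ b → A h (observe θ) ≡ output b → Run A h θ
      step : ∀ i → A h (observe θ) ≡ invest i →
             Run A (observe θ ∷ h) (updateAt θ i (_+ β)) → Run A h θ

    Halts : Online n → Set
    Halts A = Run A [] (replicate n 0#)

  module _ {n : ℕ} {β : Carrier} {c : Vector Carrier n} {x : Vec Bool n} {A : Online n} where

    result : ∀ {h θ} → Run β c x A h θ → Bool
    result (halt b _)   = b
    result (step _ _ r) = result r

    -- ‖θ‖₁ at halting, where all entries of θ are nonnegative.
    runCost : ∀ {h θ} → Run β c x A h θ → Carrier
    runCost {θ = θ} (halt _ _)   = sum θ
    runCost         (step _ _ r) = runCost r

  AlwaysHalts : ∀ {n} → Randomised (Online n) → Carrier → Vector Carrier n → Set
  AlwaysHalts A β c = ∀ j x → Halts β c x (strategy A j)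

  module _ {n : ℕ} (A : Randomised (Online n)) {β : Carrier} {c : Vector Carrier n}
           (runs : AlwaysHalts A β c) where

    onlineError : (Vec Bool n → Bool) → Carrier
    onlineError f = average A λ j → 𝔼 λ x → mismatch (result (runs j x)) (f x)

    onlineCost : Carrier
    onlineCost = average A λ j → 𝔼 λ x → runCost (runs j x)

{-# OPTIONS --safe #-}

-- The tree is pruned along the function g it should compute, D being its
-- average depth Δ.  A node i whose influence Inf_i(g) is at least ε/D is kept,
-- and g is restricted on both sides.  At any other node the query is dropped:
-- one continues in one of the two subtrees, still aiming at the unrestricted g.
-- Replacing x_i by a random bit disturbs g with probability at most Inf_i(g),
-- so on average over the two subtrees the potential error + (ε/D)·Δ does not
-- grow, and the error stays below (ε/D)·D = ε.
--
-- As g is restricted only at queried variables, the surviving nodes satisfy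
-- (ε/D)·Pr[i is queried] ≤ Inf_i(g).  Conversely a zero-error algorithm queries
-- i with probability at least Inf_i(f), so opt ≥ Σ c_i·Inf_i(f).  Investing in
-- a variable until it is revealed overshoots its cost by at most β.
module Submission where

open import Defs
open import Algebra.Bundles using (CommutativeRing)
import Algebra.Properties.CommutativeMonoid.Sum as CommutativeMonoidSum
import Algebra.Properties.Semiring.Sum as SemiringSum
import Algebra.Solver.Ring.NaturalCoefficients.Default as NaturalCoefficients
open import Data.Bool.Base using (Bool; true; false; if_then_else_; _∨_; _xor_)
open import Data.Bool.Properties using (xor-same; xor-comm)
open import Data.Fin.Base using (Fin; zero; suc)
open import Data.Fin.Properties using (_≟_)
open import Data.Fin.Subset using (⁅_⁆)
open import Data.Fin.Subset.Properties using (x∈⁅x⁆; x∈⁅y⁆⇒x≡y)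
open import Data.Maybe.Base using (Maybe; just; nothing)
open import Data.Nat.Base using (ℕ; zero; suc; pred)
import Data.Nat.Base as ℕ
import Data.Nat.Properties as ℕₚ
open import Data.Product.Base using (Σ-syntax; _×_; _,_; proj₁; proj₂)
open import Data.Sum.Base using (inj₁; inj₂)
open import Data.Vec.Base using (Vec; []; _∷_; lookup; _[_]≔_)
open import Data.Vec.Functional using (Vector; updateAt; foldr)
open import Data.Vec.Functional.Properties using (updateAt-updates; updateAt-minimal)
open import Data.Vec.Properties
  using ( lookup-zipWith; lookup-replicate; lookup⇒[]=; []=⇒lookup; lookup∘update; lookup∘update′
        ; []≔-lookup; []≔-commutes)
open import Function.Base using (_∘_)
open import Relation.Binary.Structures using (IsDecTotalOrder)
open import Relation.Binary.Bundles using (Poset)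
import Relation.Binary.Reasoning.PartialOrder as PartialOrderReasoning
open import Relation.Binary.PropositionalEquality as ≡ using (_≡_; _≢_; ≢-sym)
open import Relation.Nullary using (¬_; yes; no; contradiction)

private
  variable
    n : ℕ

-- Queried and absent variables

queried-root : ∀ i (T₀ T₁ : DecisionTree n) x →
               lookup (queried (node i T₀ T₁) x) i ≡ true
queried-root i T₀ T₁ x
  rewrite lookup-zipWith _∨_ i ⁅ i ⁆ (if lookup x i then queried T₁ x else queried T₀ x)
        | []=⇒lookup (x∈⁅x⁆ i) = ≡.refl

lookup-⁅⁆-≢ : {i j : Fin n} → i ≢ j → lookup ⁅ j ⁆ i ≡ false
lookup-⁅⁆-≢ {i = i} {j} i≢j with lookup ⁅ j ⁆ i in eq
... | true  = contradiction (x∈⁅y⁆⇒x≡y j (lookup⇒[]= i ⁅ j ⁆ eq)) i≢j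
... | false = ≡.refl

queried-branch : {i j : Fin n} → i ≢ j → ∀ T₀ T₁ x →
                 lookup (queried (node j T₀ T₁) x) i ≡
                 lookup (if lookup x j then queried T₁ x else queried T₀ x) i
queried-branch {i = i} {j} i≢j T₀ T₁ x
  rewrite lookup-zipWith _∨_ i ⁅ j ⁆ (if lookup x j then queried T₁ x else queried T₀ x)
        | lookup-⁅⁆-≢ i≢j = ≡.refl

eval-absent : ∀ {i} (T : DecisionTree n) → Absent i T → ∀ x b →
              eval T (x [ i ]≔ b) ≡ eval T x
eval-absent (leaf _) _ x b = ≡.refl
eval-absent (node j T₀ T₁) (i≢j , a₀ , a₁) x b
  rewrite lookup∘update′ (≢-sym i≢j) x b with lookup x j
... | true  = eval-absent T₁ a₁ x b
... | false = eval-absent T₀ a₀ x b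

queried-absent : ∀ {i} (T : DecisionTree n) → Absent i T → ∀ x b →
                 queried T (x [ i ]≔ b) ≡ queried T x
queried-absent (leaf _) _ x b = ≡.refl
queried-absent (node j T₀ T₁) (i≢j , a₀ , a₁) x b
  rewrite lookup∘update′ (≢-sym i≢j) x b with lookup x j
... | true  rewrite queried-absent T₁ a₁ x b = ≡.refl
... | false rewrite queried-absent T₀ a₀ x b = ≡.refl

-- This is where querying each variable at most once on a path pays off. Neither subtree reads
-- variable `i`, so fixing it merely selects a branch, and that branch can be evaluated at the
-- unmodified `x`, which is still uniform.
eval-node-≔ : ∀ i (T₀ T₁ : DecisionTree n) → Absent i T₀ → Absent i T₁ → ∀ x b →
              eval (node i T₀ T₁) (x [ i ]≔ b) ≡ (if b then eval T₁ x else eval T₀ x)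
eval-node-≔ i T₀ T₁ a₀ a₁ x b rewrite lookup∘update i x b with b
... | true  = eval-absent T₁ a₁ x true
... | false = eval-absent T₀ a₀ x false

queried-node-≔ : ∀ {i j} → i ≢ j → (T₀ T₁ : DecisionTree n) → Absent j T₀ → Absent j T₁ →
  ∀ x b → lookup (queried (node j T₀ T₁) (x [ j ]≔ b)) i ≡
          lookup (if b then queried T₁ x else queried T₀ x) i
queried-node-≔ {j = j} i≢j T₀ T₁ a₀ a₁ x b
  rewrite queried-branch i≢j T₀ T₁ (x [ j ]≔ b) | lookup∘update j x b with b
... | true  rewrite queried-absent T₁ a₁ x true = ≡.refl
... | false rewrite queried-absent T₀ a₀ x false = ≡.refl

-- Only the path taken by `x` matters here: `T` may read variable `i` elsewhere, but a bit never
-- read on this path cannot divert it.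
eval-unqueried : ∀ {i} (T : DecisionTree n) x → lookup (queried T x) i ≡ false → ∀ b →
                 eval T (x [ i ]≔ b) ≡ eval T x
eval-unqueried (leaf _) x _ b = ≡.refl
eval-unqueried {i = i} (node j T₀ T₁) x q b with i ≟ j
... | yes ≡.refl =
  contradiction (≡.trans (≡.sym (queried-root i T₀ T₁ x)) q) λ ()
... | no i≢j
  rewrite queried-branch i≢j T₀ T₁ x | lookup∘update′ (≢-sym i≢j) x b with lookup x j
...   | true  = eval-unqueried T₁ x q b
...   | false = eval-unqueried T₀ x q b

-- Following a decision tree online

-- The walk restarts from the root at every step and is steered by the revealed bits alone. It stops
-- at the first unrevealed variable, which receives the next investment.
follow : DecisionTree n → Vector (Maybe Bool) n → Action n
follow (leaf b)       r = output b
follow (node i T₀ T₁) r with r i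
... | nothing    = invest i
... | just true  = follow T₁ r
... | just false = follow T₀ r

module _ (x : Vec Bool n) (r : Vector (Maybe Bool) n)
         (r-sound : ∀ i {b} → r i ≡ just b → lookup x i ≡ b) where

  follow-output : ∀ T {b} → follow T r ≡ output b → b ≡ eval T x
  follow-output (leaf _) ≡.refl = ≡.refl
  follow-output (node i T₀ T₁) eq with r i in rᵢ
  ... | just true  rewrite r-sound i rᵢ = follow-output T₁ eq
  ... | just false rewrite r-sound i rᵢ = follow-output T₀ eq

  -- As revealed bits are correct, the walk never leaves the path of `x`. Every investment can
  -- therefore be charged to a variable that `T` queries on `x`.
  follow-queried : ∀ T {i} → follow T r ≡ invest i → lookup (queried T x) i ≡ true
  follow-queried (node j T₀ T₁) {i} eq with i ≟ j
  ... | yes ≡.refl = queried-root j T₀ T₁ x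
  ... | no i≢j rewrite queried-branch i≢j T₀ T₁ x with r j in rⱼ
  ...   | just true  rewrite r-sound j rⱼ = follow-queried T₁ eq
  ...   | just false rewrite r-sound j rⱼ = follow-queried T₀ eq
  ...   | nothing with ≡.refl ← eq = contradiction ≡.refl i≢j

follow-unrevealed : ∀ T (r : Vector (Maybe Bool) n) {i} →
                    follow T r ≡ invest i → r i ≡ nothing
follow-unrevealed (node j T₀ T₁) r eq with r j in rⱼ
... | just true  = follow-unrevealed T₁ r eq
... | just false = follow-unrevealed T₀ r eq
... | nothing with ≡.refl ← eq = rⱼ

ℕsum : Vector ℕ n → ℕ
ℕsum = foldr ℕ._+_ 0

ℕsum-pred : ∀ i (k : Vector ℕ n) {p} → k i ≡ suc p → suc (ℕsum (updateAt k i pred)) ≡ ℕsum k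
ℕsum-pred zero    k eq rewrite eq = ≡.refl
ℕsum-pred (suc i) k eq = ≡.trans (≡.sym (ℕₚ.+-suc (k zero) _))
  (≡.cong (k zero ℕ.+_) (ℕsum-pred i (k ∘ suc) eq))

-- Ordered-field arithmetic, expectation and influence

module OrderedField (ℝ : RealNumbers) where
  open RealNumbers ℝ
  open PricedQuery ℝ
  open CommutativeRing commutativeRing
    using ( -_; refl; reflexive; sym; trans; commutativeSemiring; semiring
          ; +-commutativeMonoid; +-identityʳ; +-identityˡ; +-cong; +-congˡ; +-congʳ
          ; +-assoc; +-comm; -‿inverseʳ; *-assoc; *-comm; *-identityˡ; *-identityʳ
          ; *-congˡ; *-congʳ; zeroʳ; distribˡ)
  open IsDecTotalOrder isDecTotalOrder
    using (total; antisym; isPartialOrder)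
    renaming (refl to ≤-refl; reflexive to ≤-reflexive; trans to ≤-trans)
  open NaturalCoefficients commutativeSemiring using (solve; _:=_; _:+_; _:*_; con)

  poset : Poset _ _ _
  poset = record { isPartialOrder = isPartialOrder }

  open PartialOrderReasoning poset

  +-mono-≤ : ∀ {x y u v} → x ≤ y → u ≤ v → x + u ≤ y + v
  +-mono-≤ {x} {y} {u} {v} x≤y u≤v = begin
    x + u ≤⟨ +-monoʳ-≤ x u≤v ⟩
    x + v ≈⟨ +-comm x v ⟩
    v + x ≤⟨ +-monoʳ-≤ v x≤y ⟩
    v + y ≈⟨ +-comm v y ⟩
    y + v ∎

  x≤x+y : ∀ {x y} → 0# ≤ y → x ≤ x + y
  x≤x+y {x} {y} 0≤y = begin
    x      ≈⟨ +-identityʳ x ⟨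
    x + 0# ≤⟨ +-monoʳ-≤ x 0≤y ⟩
    x + y  ∎

  +-nonNeg : ∀ {x y} → 0# ≤ x → 0# ≤ y → 0# ≤ x + y
  +-nonNeg 0≤x 0≤y = ≤-trans 0≤x (x≤x+y 0≤y)

  x≤y⇒0≤y-x : ∀ {x y} → x ≤ y → 0# ≤ y + - x
  x≤y⇒0≤y-x {x} {y} x≤y = begin
    0#      ≈⟨ -‿inverseʳ x ⟨
    x + - x ≤⟨ +-mono-≤ x≤y ≤-refl ⟩
    y + - x ∎

  *-monoˡ-≤ : ∀ {z x y} → 0# ≤ z → x ≤ y → z * x ≤ z * y
  *-monoˡ-≤ {z} {x} {y} 0≤z x≤y = begin
    z * x                 ≤⟨ x≤x+y (*-nonNeg 0≤z (x≤y⇒0≤y-x x≤y)) ⟩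
    z * x + z * (y + - x) ≈⟨ distribˡ z x (y + - x) ⟨
    z * (x + (y + - x))
      ≈⟨ *-congˡ (solve 3 (λ x y w → x :+ (y :+ w) := y :+ (x :+ w)) refl x y (- x)) ⟩
    z * (y + (x + - x))   ≈⟨ *-congˡ (+-congˡ (-‿inverseʳ x)) ⟩
    z * (y + 0#)          ≈⟨ *-congˡ (+-identityʳ y) ⟩
    z * y                 ∎

  -- If 1 ≤ 0, then -1 is nonnegative, and multiplying 1 ≤ 0 by it gives -1 ≤ 0. Adding 1 yields 0 ≤
  -- 1 in this case too.
  0≤1 : 0# ≤ 1#
  0≤1 with total 0# 1#
  ... | inj₁ 0≤1 = 0≤1
  ... | inj₂ 1≤0 = begin
    0#        ≈⟨ -‿inverseʳ 1# ⟨
    1# + - 1# ≤⟨ +-monoʳ-≤ 1# -1≤0 ⟩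
    1# + 0#   ≈⟨ +-identityʳ 1# ⟩
    1#        ∎
    where
    0≤-1 : 0# ≤ - 1#
    0≤-1 = ≤-trans (x≤y⇒0≤y-x 1≤0) (≤-reflexive (+-identityˡ (- 1#)))

    -1≤0 : - 1# ≤ 0#
    -1≤0 = begin
      - 1#      ≈⟨ *-identityʳ (- 1#) ⟨
      - 1# * 1# ≤⟨ *-monoˡ-≤ 0≤-1 1≤0 ⟩
      - 1# * 0# ≈⟨ zeroʳ (- 1#) ⟩
      0#        ∎

  1≰0 : ¬ 1# ≤ 0#
  1≰0 1≤0 = 1≉0 (antisym 1≤0 0≤1)

  ⁻¹-inverseˡ : ∀ {z} → 0# < z → z ⁻¹ * z ≈ 1#
  ⁻¹-inverseˡ {z} (_ , 0≉z) = trans (*-comm (z ⁻¹) z) (*-inverseʳ (0≉z ∘ sym))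

  ⁻¹-nonNeg : ∀ {z} → 0# < z → 0# ≤ z ⁻¹
  ⁻¹-nonNeg {z} z>0@(0≤z , 0≉z) with total 0# (z ⁻¹)
  ... | inj₁ 0≤z⁻¹ = 0≤z⁻¹
  ... | inj₂ z⁻¹≤0 = contradiction 1≤0 1≰0
    where
    1≤0 : 1# ≤ 0#
    1≤0 = begin
      1#       ≈⟨ *-inverseʳ (0≉z ∘ sym) ⟨
      z * z ⁻¹ ≤⟨ *-monoˡ-≤ 0≤z z⁻¹≤0 ⟩
      z * 0#   ≈⟨ zeroʳ z ⟩
      0#       ∎

  ⁻¹-adjoint : ∀ {z x y} → 0# < z → z * x ≤ y → x ≤ z ⁻¹ * y
  ⁻¹-adjoint {z} {x} {y} z>0 zx≤y = begin
    x              ≈⟨ *-identityˡ x ⟨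
    1# * x         ≈⟨ *-congʳ (⁻¹-inverseˡ z>0) ⟨
    z ⁻¹ * z * x   ≈⟨ *-assoc (z ⁻¹) z x ⟩
    z ⁻¹ * (z * x) ≤⟨ *-monoˡ-≤ (⁻¹-nonNeg z>0) zx≤y ⟩
    z ⁻¹ * y       ∎

  *-cancelˡ-≤ : ∀ {z x y} → 0# < z → z * x ≤ z * y → x ≤ y
  *-cancelˡ-≤ {z} {x} {y} z>0 zx≤zy = begin
    x              ≤⟨ ⁻¹-adjoint z>0 zx≤zy ⟩
    z ⁻¹ * (z * y) ≈⟨ *-assoc (z ⁻¹) z y ⟨
    z ⁻¹ * z * y   ≈⟨ *-congʳ (⁻¹-inverseˡ z>0) ⟩
    1# * y         ≈⟨ *-identityˡ y ⟩
    y              ∎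

  1≤⇒pos : ∀ {z} → 1# ≤ z → 0# < z
  1≤⇒pos 1≤z = ≤-trans 0≤1 1≤z , λ 0≈z → 1≰0 (≤-trans 1≤z (≤-reflexive (sym 0≈z)))

  2>0 : 0# < 1# + 1#
  2>0 = 1≤⇒pos (x≤x+y 0≤1)

  0≤½ : 0# ≤ ½
  0≤½ = ⁻¹-nonNeg 2>0

  ½-double : ∀ x → ½ * (x + x) ≈ x
  ½-double x = trans (*-congˡ (solve 1 (λ x → x :+ x := (con 1 :+ con 1) :* x) refl x))
    (trans (sym (*-assoc ½ (1# + 1#) x)) (trans (*-congʳ (⁻¹-inverseˡ 2>0)) (*-identityˡ x)))

  avg-mono : ∀ {x y u v} → x ≤ y → u ≤ v → ½ * (x + u) ≤ ½ * (y + v)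
  avg-mono x≤y u≤v = *-monoˡ-≤ 0≤½ (+-mono-≤ x≤y u≤v)

  avg-cong : ∀ {x y u v} → x ≈ y → u ≈ v → ½ * (x + u) ≈ ½ * (y + v)
  avg-cong x≈y u≈v = *-congˡ (+-cong x≈y u≈v)

  *-avg : ∀ d x y → d * (½ * (x + y)) ≈ ½ * (d * x + d * y)
  *-avg d x y = solve 4 (λ h d x y → d :* (h :* (x :+ y)) := h :* (d :* x :+ d :* y)) refl ½ d x y

  avg-+ : ∀ x y u v → ½ * ((x + u) + (y + v)) ≈ ½ * (x + y) + ½ * (u + v)
  avg-+ = solve 5 (λ h x y u v →
    h :* ((x :+ u) :+ (y :+ v)) := h :* (x :+ y) :+ h :* (u :+ v)) refl ½

  ≰⇒≥ : ∀ {x y} → ¬ x ≤ y → y ≤ x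
  ≰⇒≥ {x} {y} x≰y with total x y
  ... | inj₁ x≤y = contradiction x≤y x≰y
  ... | inj₂ y≤x = y≤x

  -- Finite sums and expectations

  open SemiringSum semiring using (*-distribˡ-sum)
  open CommutativeMonoidSum +-commutativeMonoid
    using (sum-cong-≋; sum-replicate; ∑-distrib-+)

  sum-mono : {g h : Vector Carrier n} → (∀ i → g i ≤ h i) → sum g ≤ sum h
  sum-mono {zero}  _   = ≤-refl
  sum-mono {suc n} g≤h = +-mono-≤ (g≤h zero) (sum-mono (g≤h ∘ suc))

  sum-nonNeg : {g : Vector Carrier n} → (∀ i → 0# ≤ g i) → 0# ≤ sum g
  sum-nonNeg {zero}  _   = ≤-refl
  sum-nonNeg {suc n} 0≤g = ≤-trans (0≤g zero) (x≤x+y (sum-nonNeg (0≤g ∘ suc)))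

  𝔼-mono : {g h : Vec Bool n → Carrier} → (∀ x → g x ≤ h x) → 𝔼 g ≤ 𝔼 h
  𝔼-mono {zero}  g≤h = g≤h []
  𝔼-mono {suc n} g≤h = avg-mono (𝔼-mono (g≤h ∘ (false ∷_))) (𝔼-mono (g≤h ∘ (true ∷_)))

  𝔼-cong : {g h : Vec Bool n → Carrier} → (∀ x → g x ≈ h x) → 𝔼 g ≈ 𝔼 h
  𝔼-cong {zero}  g≈h = g≈h []
  𝔼-cong {suc n} g≈h = avg-cong (𝔼-cong (g≈h ∘ (false ∷_))) (𝔼-cong (g≈h ∘ (true ∷_)))

  𝔼-const : ∀ n a → 𝔼 {n} (λ _ → a) ≈ a
  𝔼-const zero    a = refl
  𝔼-const (suc n) a = trans (avg-cong (𝔼-const n a) (𝔼-const n a)) (½-double a)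

  𝔼-nonNeg : {g : Vec Bool n → Carrier} → (∀ x → 0# ≤ g x) → 0# ≤ 𝔼 g
  𝔼-nonNeg {n} 0≤g = ≤-trans (≤-reflexive (sym (𝔼-const n 0#))) (𝔼-mono 0≤g)

  𝔼-+ : (g h : Vec Bool n → Carrier) → 𝔼 (λ x → g x + h x) ≈ 𝔼 g + 𝔼 h
  𝔼-+ {zero}  g h = refl
  𝔼-+ {suc n} g h =
    trans (avg-cong (𝔼-+ (g ∘ (false ∷_)) _) (𝔼-+ (g ∘ (true ∷_)) _)) (avg-+ _ _ _ _)

  𝔼-* : ∀ a (g : Vec Bool n → Carrier) → 𝔼 (λ x → a * g x) ≈ a * 𝔼 g
  𝔼-* {zero}  a g = refl
  𝔼-* {suc n} a g =
    trans (avg-cong (𝔼-* a (g ∘ (false ∷_))) (𝔼-* a (g ∘ (true ∷_)))) (sym (*-avg a _ _))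

  𝔼-sum : ∀ {k} (g : Fin k → Vec Bool n → Carrier) →
          𝔼 (λ x → sum λ i → g i x) ≈ sum λ i → 𝔼 (g i)
  𝔼-sum {n} {zero}  g = 𝔼-const n 0#
  𝔼-sum {n} {suc k} g = trans (𝔼-+ (g zero) _) (+-congˡ (𝔼-sum (g ∘ suc)))

  -- Conditioning on bit `i`. Both conditional expectations still range over all `n` bits, with bit
  -- `i` overwritten, so no reindexing to a smaller cube is needed.
  𝔼-split : ∀ i (g : Vec Bool n → Carrier) →
            𝔼 g ≈ ½ * (𝔼 (λ x → g (x [ i ]≔ false)) + 𝔼 (λ x → g (x [ i ]≔ true)))
  𝔼-split zero    g = sym (avg-cong (½-double _) (½-double _))
  𝔼-split (suc i) g = trans (avg-cong (𝔼-split i _) (𝔼-split i _))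
    (solve 5 (λ h a b c d → h :* (h :* (a :+ b) :+ h :* (c :+ d)) :=
                            h :* (h :* (a :+ c) :+ h :* (b :+ d))) refl ½ _ _ _ _)

  -- Indicators

  𝟙 : Bool → Carrier
  𝟙 b = if b then 1# else 0#

  0≤𝟙 : ∀ b → 0# ≤ 𝟙 b
  0≤𝟙 false = ≤-refl
  0≤𝟙 true  = 0≤1

  𝟙≤1 : ∀ b → 𝟙 b ≤ 1#
  𝟙≤1 false = 0≤1
  𝟙≤1 true  = ≤-refl

  mismatch-refl : ∀ b → mismatch b b ≡ 0#
  mismatch-refl b = ≡.cong 𝟙 (xor-same b)

  mismatch-sym : ∀ b b′ → mismatch b b′ ≡ mismatch b′ b
  mismatch-sym b b′ = ≡.cong 𝟙 (xor-comm b b′)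

  mismatch-nonNeg : ∀ b b′ → 0# ≤ mismatch b b′
  mismatch-nonNeg b b′ = 0≤𝟙 (b xor b′)

  mismatch-triangle : ∀ a b c → mismatch a c ≤ mismatch a b + mismatch b c
  mismatch-triangle true  true  c = ≤-reflexive (sym (+-identityˡ _))
  mismatch-triangle false false c = ≤-reflexive (sym (+-identityˡ _))
  mismatch-triangle true  false true  = ≤-trans 0≤1 (x≤x+y 0≤1)
  mismatch-triangle true  false false = x≤x+y ≤-refl
  mismatch-triangle false true  true  = x≤x+y ≤-refl
  mismatch-triangle false true  false = ≤-trans 0≤1 (x≤x+y 0≤1)

  -- Influences and the lower bound on opt

  -- The arity stays `n`, so the restricted function can be compared with trees over the same
  -- variables and restricted again.
  restrict : Fin n → Bool → (Vec Bool n → Bool) → (Vec Bool n → Bool)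
  restrict i b g x = g (x [ i ]≔ b)

  -- The probability that flipping bit `i` of a uniform input changes the value of `g`.
  influence : Fin n → (Vec Bool n → Bool) → Carrier
  influence i g = 𝔼 λ x → mismatch (restrict i false g x) (restrict i true g x)

  err : DecisionTree n → (Vec Bool n → Bool) → Carrier
  err S g = 𝔼 λ x → mismatch (eval S x) (g x)

  ℙ-queried : DecisionTree n → Fin n → Carrier
  ℙ-queried S i = 𝔼 λ x → 𝟙 (lookup (queried S x) i)

  influence-nonNeg : ∀ i (g : Vec Bool n → Bool) → 0# ≤ influence i g
  influence-nonNeg i g = 𝔼-nonNeg λ x →
    mismatch-nonNeg (restrict i false g x) (restrict i true g x)

  influence-split : ∀ {i j} → i ≢ j → (g : Vec Bool n → Bool) →
    influence i g ≈ ½ * (influence i (restrict j false g) + influence i (restrict j true g))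
  influence-split {i = i} {j} i≢j g =
    trans (𝔼-split j _) (avg-cong (𝔼-cong (swap false)) (𝔼-cong (swap true)))
    where
    swap : ∀ b x → mismatch (g ((x [ j ]≔ b) [ i ]≔ false)) (g ((x [ j ]≔ b) [ i ]≔ true)) ≈
                   mismatch (g ((x [ i ]≔ false) [ j ]≔ b)) (g ((x [ i ]≔ true) [ j ]≔ b))
    swap b x
      rewrite []≔-commutes {x = b} {y = false} x j i (≢-sym i≢j)
            | []≔-commutes {x = b} {y = true} x j i (≢-sym i≢j) = refl

  -- If `S` does not query `i` on `x`, it answers alike for both values of that bit. If moreover `f`
  -- changes with the bit, `S` errs for one of the two values.
  influence≤queried+err : ∀ (S : DecisionTree n) f i →
                          influence i f ≤ ℙ-queried S i + (err S f + err S f)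
  influence≤queried+err S f i = begin
    influence i f                                   ≤⟨ 𝔼-mono pointwise ⟩
    𝔼 (λ x → 𝟙 (q x) + (m false x + m true x))      ≈⟨ 𝔼-+ (𝟙 ∘ q) _ ⟩
    ℙ-queried S i + 𝔼 (λ x → m false x + m true x)  ≈⟨ +-congˡ (𝔼-+ (m false) (m true)) ⟩
    -- Conditioning on bit `i` shows that half of this sum of two errors is `err S f`, which is why
    -- the error appears twice in the bound.
    ℙ-queried S i + (𝔼 (m false) + 𝔼 (m true))      ≈⟨ +-congˡ (½-double _) ⟨
    ℙ-queried S i + ½ * ((𝔼 (m false) + 𝔼 (m true)) + (𝔼 (m false) + 𝔼 (m true)))
      ≈⟨ +-congˡ (distribˡ ½ _ _) ⟩
    ℙ-queried S i + (½ * (𝔼 (m false) + 𝔼 (m true)) + ½ * (𝔼 (m false) + 𝔼 (m true)))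
      ≈⟨ +-congˡ (+-cong (𝔼-split i _) (𝔼-split i _)) ⟨
    ℙ-queried S i + (err S f + err S f)             ∎
    where
    q : Vec Bool _ → Bool
    q x = lookup (queried S x) i

    m : Bool → Vec Bool _ → Carrier
    m b x = mismatch (eval S (x [ i ]≔ b)) (f (x [ i ]≔ b))

    m-nonNeg : ∀ b x → 0# ≤ m b x
    m-nonNeg b x = mismatch-nonNeg (eval S (x [ i ]≔ b)) (f (x [ i ]≔ b))

    pointwise : ∀ x → mismatch (f (x [ i ]≔ false)) (f (x [ i ]≔ true)) ≤
                      𝟙 (q x) + (m false x + m true x)
    pointwise x with lookup (queried S x) i in eq
    ... | true  = ≤-trans (𝟙≤1 (f _ xor f _))
                    (x≤x+y (≤-trans (m-nonNeg false x) (x≤x+y (m-nonNeg true x))))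
    ... | false
      rewrite eval-unqueried S x eq false | eval-unqueried S x eq true
            | mismatch-sym (eval S x) (f (x [ i ]≔ false)) =
      ≤-trans (mismatch-triangle (f (x [ i ]≔ false)) (eval S x) (f (x [ i ]≔ true)))
              (≤-reflexive (sym (+-identityˡ _)))

  totalInfluence : Vector Carrier n → (Vec Bool n → Bool) → Carrier
  totalInfluence c f = sum λ i → c i * influence i f

  expected-price : ∀ (S : DecisionTree n) (c : Vector Carrier n) →
    (𝔼 λ x → sum λ i → if lookup (queried S x) i then c i else 0#) ≈
    sum λ i → c i * ℙ-queried S i
  expected-price S c = trans (𝔼-sum price) (sum-cong-≋ λ i →
      trans (𝔼-cong (λ x → price-𝟙 (lookup (queried S x) i)))
            (𝔼-* (c i) (λ x → 𝟙 (lookup (queried S x) i))))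
    where
    price : Fin _ → Vec Bool _ → Carrier
    price i x = if lookup (queried S x) i then c i else 0#

    price-𝟙 : ∀ b {a} → (if b then a else 0#) ≈ a * 𝟙 b
    price-𝟙 true  = sym (*-identityʳ _)
    price-𝟙 false = sym (zeroʳ _)

  -- The error term is kept because a single strategy of a mixture is not known to be exact. Its
  -- factor comes from summing the doubled error against the costs.
  totalInfluence≤price+err : ∀ (S : DecisionTree n) f c → (∀ i → 0# ≤ c i) →
    totalInfluence c f ≤ sum (λ i → c i * ℙ-queried S i) + (sum c + sum c) * err S f
  totalInfluence≤price+err S f c 0≤c = begin
    sum (λ i → c i * influence i f)
      ≤⟨ sum-mono (λ i → *-monoˡ-≤ (0≤c i) (influence≤queried+err S f i)) ⟩
    sum (λ i → c i * (ℙ-queried S i + (e + e)))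
      ≈⟨ sum-cong-≋ (λ i → solve 3 (λ c p e → c :* (p :+ (e :+ e)) := c :* p :+ (e :+ e) :* c)
                                   refl (c i) (ℙ-queried S i) e) ⟩
    sum (λ i → c i * ℙ-queried S i + (e + e) * c i)
      ≈⟨ ∑-distrib-+ (λ i → c i * ℙ-queried S i) (λ i → (e + e) * c i) ⟩
    sum (λ i → c i * ℙ-queried S i) + sum (λ i → (e + e) * c i)
      ≈⟨ +-congˡ (*-distribˡ-sum (e + e) c) ⟨
    sum (λ i → c i * ℙ-queried S i) + (e + e) * sum c
      ≈⟨ +-congˡ (solve 2 (λ e s → (e :+ e) :* s := (s :+ s) :* e) refl e (sum c)) ⟩
    sum (λ i → c i * ℙ-queried S i) + (sum c + sum c) * e ∎
    where
    e : Carrier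
    e = err S f

  -- The multiple of the error avoids treating strategies of weight zero
  -- separately: by linearity it vanishes on average.
  totalInfluence≤offlineCost : ∀ (B : Randomised (DecisionTree n)) f c → (∀ i → 0# ≤ c i) →
    offlineError B f ≈ 0# → totalInfluence c f ≤ offlineCost B c
  totalInfluence≤offlineCost B f c 0≤c B-exact = begin
    L                                        ≈⟨ *-identityʳ L ⟨
    L * 1#                                   ≈⟨ *-congˡ total-weight ⟨
    L * sum weight                           ≈⟨ *-distribˡ-sum L weight ⟩
    sum (λ j → L * weight j)                 ≤⟨ sum-mono termwise ⟩
    sum (λ j → weight j * cost j + K * (weight j * error j))
                                             ≈⟨ ∑-distrib-+ (λ j → weight j * cost j) _ ⟩
    offlineCost B c + sum (λ j → K * (weight j * error j))
                                             ≈⟨ +-congˡ (*-distribˡ-sum K (λ j → weight j * error j)) ⟨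
    offlineCost B c + K * offlineError B f   ≈⟨ +-congˡ (*-congˡ B-exact) ⟩
    offlineCost B c + K * 0#                 ≈⟨ +-congˡ (zeroʳ K) ⟩
    offlineCost B c + 0#                     ≈⟨ +-identityʳ _ ⟩
    offlineCost B c                          ∎
    where
    open Randomised B renaming (total to total-weight)

    L K : Carrier
    L = totalInfluence c f
    K = sum c + sum c

    cost error : Vector Carrier size
    cost j  = 𝔼 λ x → sum λ i → if lookup (queried (strategy j) x) i then c i else 0#
    error j = err (strategy j) f

    termwise : ∀ j → L * weight j ≤ weight j * cost j + K * (weight j * error j)
    termwise j = begin
      L * weight j                                 ≈⟨ *-comm L (weight j) ⟩
      weight j * L                                 ≤⟨ *-monoˡ-≤ (nonNeg j) (begin
        L
          ≤⟨ totalInfluence≤price+err (strategy j) f c 0≤c ⟩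
        sum (λ i → c i * ℙ-queried (strategy j) i) + K * error j
                                                        ≈⟨ +-congʳ (expected-price (strategy j) c) ⟨
        cost j + K * error j                            ∎) ⟩
      weight j * (cost j + K * error j)            ≈⟨ solve 4 (λ w a k e →
                                                        w :* (a :+ k :* e) := w :* a :+ k :* (w :* e))
                                                        refl (weight j) (cost j) K (error j) ⟩
      weight j * cost j + K * (weight j * error j) ∎

  pointMass : ∀ {A : Set} → A → Randomised A
  pointMass a = record
    { size     = 1
    ; weight   = λ _ → 1#
    ; strategy = λ _ → a
    ; nonNeg   = λ _ → 0≤1
    ; total    = +-identityʳ 1#
    }

  average-pointMass : ∀ {A : Set} (a : A) v → Randomised.average (pointMass a) (λ _ → v) ≈ v
  average-pointMass a v = trans (+-identityʳ _) (*-identityˡ v)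

  err-computes : ∀ (T : DecisionTree n) {f} → Computes T f → err T f ≈ 0#
  err-computes {n} T {f} T-computes = trans
    (𝔼-cong (λ x → reflexive
      (≡.trans (≡.cong (mismatch (eval T x)) (≡.sym (T-computes x))) (mismatch-refl (eval T x)))))
    (𝔼-const n 0#)

  totalInfluence≤opt : ∀ (T : DecisionTree n) {f} c → (∀ i → 0# ≤ c i) → Computes T f →
                       totalInfluence c f ≤ opt f c
  totalInfluence≤opt T {f} c 0≤c T-computes = inf-greatest (ZeroErrorCost f c)
    -- `T` itself is an exact competitor, so the set of costs is nonempty. The influence bound
    -- serves both as evidence that the set is bounded below and as the bound to be compared with
    -- the infimum.
    (_ , pointMass T , trans (average-pointMass T _) (err-computes T T-computes) , refl)
    (_ , bound) bound
    where
    bound : IsLowerBound (ZeroErrorCost f c) (totalInfluence c f)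
    bound (B , B-exact , cost≈v) =
      ≤-trans (totalInfluence≤offlineCost B f c 0≤c B-exact) (≤-reflexive cost≈v)

  -- Pruning

  err-node : ∀ i (T₀ T₁ : DecisionTree n) g → Absent i T₀ → Absent i T₁ →
    err (node i T₀ T₁) g ≈ ½ * (err T₀ (restrict i false g) + err T₁ (restrict i true g))
  err-node i T₀ T₁ g a₀ a₁ = trans (𝔼-split i _)
    (avg-cong (𝔼-cong (λ x → reflexive (branch x false))) (𝔼-cong (λ x → reflexive (branch x true))))
    where
    branch : ∀ x b → mismatch (eval (node i T₀ T₁) (x [ i ]≔ b)) (g (x [ i ]≔ b)) ≡
                     mismatch (if b then eval T₁ x else eval T₀ x) (restrict i b g x)
    branch x b = ≡.cong (λ v → mismatch v _) (eval-node-≔ i T₀ T₁ a₀ a₁ x b)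

  -- Triangle inequality through the restricted function: overwriting bit `i` can change the value
  -- of `g` only at inputs where `g` is sensitive to that bit.
  err≤err-restrict+influence : ∀ i b (S : DecisionTree n) g → Absent i S →
                               err S g ≤ err S (restrict i b g) + influence i g
  err≤err-restrict+influence i b S g a = ≤-trans
    (𝔼-mono λ x → ≤-trans (mismatch-triangle (eval S x) (restrict i b g x) (g x))
                          (+-monoʳ-≤ _ (resample x)))
    (≤-reflexive (𝔼-+ (λ x → mismatch (eval S x) (restrict i b g x)) _))
    where
    either : ∀ (h : Bool → Bool) b b′ → mismatch (h b) (h b′) ≤ mismatch (h false) (h true)
    either h false true  = ≤-refl
    either h true  false = ≤-reflexive (reflexive (mismatch-sym (h true) (h false)))
    either h true  true  = ≤-trans (≤-reflexive (reflexive (mismatch-refl (h true))))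
                                   (mismatch-nonNeg (h false) (h true))
    either h false false = ≤-trans (≤-reflexive (reflexive (mismatch-refl (h false))))
                                   (mismatch-nonNeg (h false) (h true))

    resample : ∀ x → mismatch (restrict i b g x) (g x) ≤
                     mismatch (restrict i false g x) (restrict i true g x)
    -- Writing the bit of `x` back into place presents `g x` as a value of the same one-bit function
    -- whose two values define the influence.
    resample x = ≡.subst (λ y → mismatch (restrict i b g x) (g y) ≤
                       mismatch (restrict i false g x) (restrict i true g x)) ([]≔-lookup x i)
      (either (λ b′ → g (x [ i ]≔ b′)) b (lookup x i))

  ℙ-queried-node : ∀ {i j} → i ≢ j → (T₀ T₁ : DecisionTree n) → Absent j T₀ → Absent j T₁ →
    ℙ-queried (node j T₀ T₁) i ≈ ½ * (ℙ-queried T₀ i + ℙ-queried T₁ i)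
  ℙ-queried-node {j = j} i≢j T₀ T₁ a₀ a₁ = trans (𝔼-split j _) (avg-cong
    (𝔼-cong λ x → reflexive (≡.cong 𝟙 (queried-node-≔ i≢j T₀ T₁ a₀ a₁ x false)))
    (𝔼-cong λ x → reflexive (≡.cong 𝟙 (queried-node-≔ i≢j T₀ T₁ a₀ a₁ x true))))

  module Pruning (ε D : Carrier) where

    -- The error plus `ε`/`D` times the depth, scaled by `D`. This avoids dividing by `D`, which is
    -- zero for a single leaf.
    potential : DecisionTree n → (Vec Bool n → Bool) → Carrier
    potential S g = D * err S g + ε * Δ S

    -- At a dropped node the random choice of a subtree is derandomised: the subtree of smaller
    -- potential, measured before pruning, does at least as well as the average.
    prune : DecisionTree n → (Vec Bool n → Bool) → DecisionTree n
    prune (leaf b)       g = leaf b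
    prune (node i S₀ S₁) g with ε ≤? D * influence i g | potential S₀ g ≤? potential S₁ g
    ... | yes _ | _     = node i (prune S₀ (restrict i false g)) (prune S₁ (restrict i true g))
    ... | no _  | yes _ = prune S₀ g
    ... | no _  | no _  = prune S₁ g

    prune-absent : ∀ {i} (S : DecisionTree n) g → Absent i S → Absent i (prune S g)
    prune-absent (leaf b) g _ = _
    prune-absent (node j S₀ S₁) g (i≢j , a₀ , a₁)
      with ε ≤? D * influence j g | potential S₀ g ≤? potential S₁ g
    ... | yes _ | _     = i≢j , prune-absent S₀ _ a₀ , prune-absent S₁ _ a₁
    ... | no _  | yes _ = prune-absent S₀ g a₀
    ... | no _  | no _  = prune-absent S₁ g a₁

  module PruningBounds {ε D : Carrier} (0≤D : 0# ≤ D) (0≤ε : 0# ≤ ε) where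
    open Pruning ε D

    -- Descending from the root lowers the average depth by one and so releases `ε` of potential.
    -- That amount may be spent on additional error, weighted by `D`.
    avg-potential : ∀ i (S₀ S₁ : DecisionTree n) g g₀ g₁ →
      D * (½ * (err S₀ g₀ + err S₁ g₁)) ≤ D * err (node i S₀ S₁) g + ε →
      ½ * (potential S₀ g₀ + potential S₁ g₁) ≤ potential (node i S₀ S₁) g
    avg-potential i S₀ S₁ g g₀ g₁ le = begin
      ½ * (potential S₀ g₀ + potential S₁ g₁)
        ≈⟨ solve 7 (λ h d e x y u v → h :* ((d :* x :+ e :* u) :+ (d :* y :+ e :* v)) :=
                                      e :* (h :* (u :+ v)) :+ d :* (h :* (x :+ y)))
                   refl ½ D ε (err S₀ g₀) (err S₁ g₁) (Δ S₀) (Δ S₁) ⟩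
      ε * m + D * (½ * (err S₀ g₀ + err S₁ g₁))
        ≤⟨ +-monoʳ-≤ _ le ⟩
      ε * m + (D * err (node i S₀ S₁) g + ε)
        ≈⟨ solve 3 (λ e m x → e :* m :+ (x :+ e) := x :+ e :* (con 1 :+ m))
                   refl ε m (D * err (node i S₀ S₁) g) ⟩
      potential (node i S₀ S₁) g ∎
      where
      m : Carrier
      m = ½ * (Δ S₀ + Δ S₁)

    -- Restricting `g` along with the branch leaves the average error unchanged, so the released `ε`
    -- is pure slack.
    keep-potential : ∀ i (S₀ S₁ : DecisionTree n) g → Absent i S₀ → Absent i S₁ →
      ½ * (potential S₀ (restrict i false g) + potential S₁ (restrict i true g)) ≤
      potential (node i S₀ S₁) g
    keep-potential i S₀ S₁ g a₀ a₁ = avg-potential i S₀ S₁ g _ _ (≤-trans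
      (≤-reflexive (*-congˡ (sym (err-node i S₀ S₁ g a₀ a₁)))) (x≤x+y 0≤ε))

    -- Aiming at the unrestricted `g` costs each subtree at most the influence of `i` in error.
    -- After weighting by `D`, the released `ε` covers this.
    drop-potential : ∀ i (S₀ S₁ : DecisionTree n) g → Absent i S₀ → Absent i S₁ →
      D * influence i g ≤ ε →
      ½ * (potential S₀ g + potential S₁ g) ≤ potential (node i S₀ S₁) g
    drop-potential i S₀ S₁ g a₀ a₁ small = avg-potential i S₀ S₁ g g g (begin
      D * (½ * (err S₀ g + err S₁ g))
        ≤⟨ *-monoˡ-≤ 0≤D (avg-mono (err≤err-restrict+influence i false S₀ g a₀)
                                   (err≤err-restrict+influence i true S₁ g a₁)) ⟩
      D * (½ * ((e₀ + I) + (e₁ + I)))   ≈⟨ *-congˡ (avg-+ e₀ e₁ I I) ⟩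
      D * (½ * (e₀ + e₁) + ½ * (I + I))
        ≈⟨ *-congˡ (+-cong (sym (err-node i S₀ S₁ g a₀ a₁)) (½-double I)) ⟩
      D * (err (node i S₀ S₁) g + I)    ≈⟨ distribˡ D _ _ ⟩
      D * err (node i S₀ S₁) g + D * I  ≤⟨ +-monoʳ-≤ _ small ⟩
      D * err (node i S₀ S₁) g + ε      ∎)
      where
      I e₀ e₁ : Carrier
      I  = influence i g
      e₀ = err S₀ (restrict i false g)
      e₁ = err S₁ (restrict i true g)

    -- Induction on the tree. Kept nodes average the two hypotheses; at dropped nodes the chosen
    -- potential is the smaller one, hence at most the average.
    prune-err : ∀ (S : DecisionTree n) g → ReadOnce S → D * err (prune S g) g ≤ potential S g
    prune-err (leaf b) g _ = x≤x+y (≤-reflexive (sym (zeroʳ ε)))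
    prune-err (node i S₀ S₁) g (a₀ , a₁ , r₀ , r₁)
      with ε ≤? D * influence i g | potential S₀ g ≤? potential S₁ g
    ... | yes _ | _ = begin
      D * err (node i P₀ P₁) g
        ≈⟨ *-congˡ (err-node i P₀ P₁ g (prune-absent S₀ g₀ a₀)
                                                    (prune-absent S₁ g₁ a₁)) ⟩
      D * (½ * (err P₀ g₀ + err P₁ g₁))          ≈⟨ *-avg D _ _ ⟩
      ½ * (D * err P₀ g₀ + D * err P₁ g₁)
        ≤⟨ avg-mono (prune-err S₀ g₀ r₀) (prune-err S₁ g₁ r₁) ⟩
      ½ * (potential S₀ g₀ + potential S₁ g₁)    ≤⟨ keep-potential i S₀ S₁ g a₀ a₁ ⟩
      potential (node i S₀ S₁) g                 ∎
      where
      g₀ g₁ : Vec Bool _ → Bool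
      g₀ = restrict i false g
      g₁ = restrict i true g
      P₀ P₁ : DecisionTree _
      P₀ = prune S₀ g₀
      P₁ = prune S₁ g₁
    ... | no ε≰DI | yes Φ₀≤Φ₁ = begin
      D * err (prune S₀ g) g                  ≤⟨ prune-err S₀ g r₀ ⟩
      potential S₀ g                          ≈⟨ ½-double _ ⟨
      ½ * (potential S₀ g + potential S₀ g)   ≤⟨ avg-mono ≤-refl Φ₀≤Φ₁ ⟩
      ½ * (potential S₀ g + potential S₁ g)   ≤⟨ drop-potential i S₀ S₁ g a₀ a₁ (≰⇒≥ ε≰DI) ⟩
      potential (node i S₀ S₁) g              ∎
    ... | no ε≰DI | no Φ₀≰Φ₁ = begin
      D * err (prune S₁ g) g                  ≤⟨ prune-err S₁ g r₁ ⟩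
      potential S₁ g                          ≈⟨ ½-double _ ⟨
      ½ * (potential S₁ g + potential S₁ g)   ≤⟨ avg-mono (≰⇒≥ Φ₀≰Φ₁) ≤-refl ⟩
      ½ * (potential S₀ g + potential S₁ g)   ≤⟨ drop-potential i S₀ S₁ g a₀ a₁ (≰⇒≥ ε≰DI) ⟩
      potential (node i S₀ S₁) g              ∎

    -- At a kept root the threshold test gives the bound for the root variable, as a probability is
    -- at most 1. For other variables, query probability and influence both average over the two
    -- branches. At a dropped node `g` is passed on unchanged, so the hypothesis for the chosen
    -- subtree already concerns the influence in `g`.
    prune-queried : ∀ (S : DecisionTree n) g → ReadOnce S → ∀ i →
                    ε * ℙ-queried (prune S g) i ≤ D * influence i g
    prune-queried {n} (leaf b) g _ i = begin
      ε * ℙ-queried {n} (leaf b) i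
        ≈⟨ *-congˡ (trans
          (𝔼-cong {n} λ x → reflexive (≡.cong 𝟙 (lookup-replicate i false))) (𝔼-const n 0#)) ⟩
      ε * 0#                       ≈⟨ zeroʳ ε ⟩
      0#                           ≤⟨ *-nonNeg 0≤D (influence-nonNeg i g) ⟩
      D * influence i g            ∎
    prune-queried {n} (node j S₀ S₁) g (a₀ , a₁ , r₀ , r₁) i
      with ε ≤? D * influence j g | potential S₀ g ≤? potential S₁ g
    ... | no _ | yes _ = prune-queried S₀ g r₀ i
    ... | no _ | no _  = prune-queried S₁ g r₁ i
    ... | yes ε≤DI | _ with i ≟ j
    ...   | yes ≡.refl = begin
      ε * ℙ-queried (node j P₀ P₁) j
        ≤⟨ *-monoˡ-≤ 0≤ε (𝔼-mono λ x → 𝟙≤1 (lookup (queried (node j P₀ P₁) x) j)) ⟩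
      ε * 𝔼 {n} (λ _ → 1#)            ≈⟨ *-congˡ (𝔼-const n 1#) ⟩
      ε * 1#                          ≈⟨ *-identityʳ ε ⟩
      ε                               ≤⟨ ε≤DI ⟩
      D * influence j g               ∎
      where
      P₀ P₁ : DecisionTree _
      P₀ = prune S₀ (restrict j false g)
      P₁ = prune S₁ (restrict j true g)
    ...   | no i≢j = begin
      ε * ℙ-queried (node j P₀ P₁) i
        ≈⟨ *-congˡ (ℙ-queried-node i≢j P₀ P₁ (prune-absent S₀ g₀ a₀)
                                                    (prune-absent S₁ g₁ a₁)) ⟩
      ε * (½ * (ℙ-queried P₀ i + ℙ-queried P₁ i))       ≈⟨ *-avg ε _ _ ⟩
      ½ * (ε * ℙ-queried P₀ i + ε * ℙ-queried P₁ i)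
        ≤⟨ avg-mono (prune-queried S₀ g₀ r₀ i) (prune-queried S₁ g₁ r₁ i) ⟩
      ½ * (D * influence i g₀ + D * influence i g₁)     ≈⟨ *-avg D _ _ ⟨
      D * (½ * (influence i g₀ + influence i g₁))       ≈⟨ *-congˡ (influence-split i≢j g) ⟨
      D * influence i g                                 ∎
      where
      g₀ g₁ : Vec Bool _ → Bool
      g₀ = restrict j false g
      g₁ = restrict j true g
      P₀ P₁ : DecisionTree _
      P₀ = prune S₀ g₀
      P₁ = prune S₁ g₁

  -- Online runs

  follower : DecisionTree n → Online n
  follower T _ s = follow T (Snapshot.revealed s)

  module _ (T : DecisionTree n) {β : Carrier} {c : Vector Carrier n} {x : Vec Bool n} where

    revealed : Vector Carrier n → Vector (Maybe Bool) n
    revealed θ = Snapshot.revealed (observe β c x θ)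

    revealed-sound : ∀ θ i {b} → revealed θ i ≡ just b → lookup x i ≡ b
    revealed-sound θ i eq with c i ≤? θ i | eq
    ... | yes _ | ≡.refl = ≡.refl
    ... | no _  | ()

    revealed-nothing : ∀ θ i → revealed θ i ≡ nothing → ¬ c i ≤ θ i
    revealed-nothing θ i eq with c i ≤? θ i | eq
    ... | yes _   | ()
    ... | no c≰θ | _ = c≰θ

    result-correct : ∀ {h θ} (r : Run β c x (follower T) h θ) → result r ≡ eval T x
    result-correct {θ = θ} (halt b eq) =
      follow-output x (revealed θ) (revealed-sound θ) T eq
    result-correct (step _ _ r) = result-correct r

    -- The most that is ever invested in each variable on input `x`. The overshoot `β` is allowed
    -- even for unqueried variables; summed up, it becomes the additive term `n · β`.
    price : Vector Carrier n
    price i = β + c i * 𝟙 (lookup (queried T x) i)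

    -- The bound is an invariant of the run. An investment goes only to a variable that is on the
    -- path of `x` and still unrevealed, so its earlier total is at most its cost and one more `β`
    -- stays within the price.
    runCost≤price : ∀ {h θ} (r : Run β c x (follower T) h θ) → (∀ i → θ i ≤ price i) →
                    runCost r ≤ sum price
    runCost≤price (halt _ _) θ≤price = sum-mono θ≤price
    runCost≤price {θ = θ} (step i eq r) θ≤price = runCost≤price r θ′≤price
      where
      paid : θ i + β ≤ price i
      paid rewrite follow-queried x (revealed θ) (revealed-sound θ) T eq = begin
        θ i + β      ≈⟨ +-comm (θ i) β ⟩
        β + θ i
          ≤⟨ +-monoʳ-≤ β (≰⇒≥ (revealed-nothing θ i (follow-unrevealed T (revealed θ) eq))) ⟩
        β + c i      ≈⟨ +-congˡ (*-identityʳ (c i)) ⟨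
        β + c i * 1# ∎

      θ′≤price : ∀ j → updateAt θ i (_+ β) j ≤ price j
      θ′≤price j with j ≟ i
      ... | yes ≡.refl rewrite updateAt-updates i {_+ β} θ = paid
      ... | no j≢i rewrite updateAt-minimal j i {_+ β} θ j≢i = θ≤price j

    -- k i bounds the number of investments still to be made in x_i.
    run : ∀ {h θ} fuel (k : Vector ℕ n) → ℕsum k ≡ fuel →
          (∀ i → c i ≤ θ i + k i · β) → Run β c x (follower T) h θ
    run {h} {θ} fuel k k-sum c≤ with follow T (revealed θ) in eq
    ... | output b = halt b eq
    ... | invest i with k i in kᵢ | fuel
    ...   | zero  | _ = contradiction c≤θ (revealed-nothing θ i (follow-unrevealed T (revealed θ) eq))
      where
      c≤θ : c i ≤ θ i
      c≤θ = ≤-trans (c≤ i) (≤-reflexive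
        (trans (+-congˡ (reflexive (≡.cong (_· β) kᵢ))) (+-identityʳ (θ i))))
    ...   | suc p | zero = contradiction (≡.trans (ℕsum-pred i k kᵢ) k-sum) λ ()
    ...   | suc p | suc fuel′ = step i eq (run fuel′ (updateAt k i pred)
              (ℕₚ.suc-injective (≡.trans (ℕsum-pred i k kᵢ) k-sum)) c≤′)
      where
      c≤′ : ∀ j → c j ≤ updateAt θ i (_+ β) j + updateAt k i pred j · β
      c≤′ j with j ≟ i
      ... | yes ≡.refl
        rewrite updateAt-updates i {_+ β} θ | updateAt-updates i {pred} k | kᵢ = begin
          c i               ≤⟨ c≤ i ⟩
          θ i + k i · β     ≡⟨ ≡.cong (λ m → θ i + m · β) kᵢ ⟩
          θ i + (β + p · β) ≈⟨ +-assoc (θ i) β (p · β) ⟨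
          θ i + β + p · β   ∎
      ... | no j≢i
        rewrite updateAt-minimal j i {_+ β} θ j≢i | updateAt-minimal j i {pred} k j≢i = c≤ j

  -- Error and cost of following the pruned tree

  Δ-nonNeg : ∀ (T : DecisionTree n) → 0# ≤ Δ T
  Δ-nonNeg (leaf _)       = ≤-refl
  Δ-nonNeg (node i T₀ T₁) = ≤-trans 0≤1 (x≤x+y (*-nonNeg 0≤½ (+-nonNeg (Δ-nonNeg T₀) (Δ-nonNeg T₁))))

  1≤Δ-node : ∀ (i : Fin n) T₀ T₁ → 1# ≤ Δ (node i T₀ T₁)
  1≤Δ-node i T₀ T₁ = x≤x+y (*-nonNeg 0≤½ (+-nonNeg (Δ-nonNeg T₀) (Δ-nonNeg T₁)))

  -- The target is `eval T` rather than `f`, so pruning is determined by `ε` and `T` alone.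
  pruned : Carrier → DecisionTree n → DecisionTree n
  pruned ε T = Pruning.prune ε (Δ T) T (eval T)

  module _ {ε : Carrier} (0<ε : 0# < ε) where

    private
      0≤ε : 0# ≤ ε
      0≤ε = proj₁ 0<ε

    -- An exact tree has potential `ε * Δ T`, and the factor `Δ T` cancels. A leaf is treated
    -- separately since its depth is zero; for any other tree the depth is at least 1.
    pruned-err : ∀ (T : DecisionTree n) → ReadOnce T → err (pruned ε T) (eval T) ≤ ε
    pruned-err {n} (leaf b) _ = ≤-trans (≤-reflexive (err-computes {n} (leaf b) λ _ → ≡.refl)) 0≤ε
    pruned-err T@(node i T₀ T₁) T-readOnce = *-cancelˡ-≤ (1≤⇒pos (1≤Δ-node i T₀ T₁)) (begin
      Δ T * err (pruned ε T) (eval T)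
        ≤⟨ PruningBounds.prune-err (Δ-nonNeg T) 0≤ε T (eval T) T-readOnce ⟩
      Δ T * err T (eval T) + ε * Δ T    ≈⟨ +-congʳ (*-congˡ (err-computes T λ _ → ≡.refl)) ⟩
      Δ T * 0# + ε * Δ T                ≈⟨ +-cong (zeroʳ (Δ T)) (*-comm ε (Δ T)) ⟩
      0# + Δ T * ε                      ≈⟨ +-identityˡ _ ⟩
      Δ T * ε                           ∎)

    -- Each query probability is at most `Δ T * ε ⁻¹` times the influence of that variable. Weighted
    -- by the costs, the influences sum to at most `opt f c`.
    pruned-price : ∀ (T : DecisionTree n) {f} c → (∀ i → 0# ≤ c i) → ReadOnce T → Computes T f →
                   sum (λ i → c i * ℙ-queried (pruned ε T) i) ≤ opt f c * (Δ T * ε ⁻¹)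
    pruned-price T {f} c 0≤c T-readOnce T-computes = begin
      sum (λ i → c i * ℙ-queried (pruned ε T) i)
        ≤⟨ sum-mono (λ i → *-monoˡ-≤ (0≤c i) (⁻¹-adjoint 0<ε
             (PruningBounds.prune-queried (Δ-nonNeg T) 0≤ε T (eval T) T-readOnce i))) ⟩
      sum (λ i → c i * (ε ⁻¹ * (Δ T * influence i (eval T))))
        ≈⟨ sum-cong-≋ (λ i → solve 4 (λ c e d x → c :* (e :* (d :* x)) := (d :* e) :* (c :* x))
                                     refl (c i) (ε ⁻¹) (Δ T) (influence i (eval T))) ⟩
      sum (λ i → (Δ T * ε ⁻¹) * (c i * influence i (eval T)))
        ≈⟨ *-distribˡ-sum (Δ T * ε ⁻¹) (λ i → c i * influence i (eval T)) ⟨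
      (Δ T * ε ⁻¹) * totalInfluence c (eval T)
        ≈⟨ *-congˡ (sum-cong-≋ λ i → *-congˡ (influence-cong i)) ⟩
      (Δ T * ε ⁻¹) * totalInfluence c f
        ≤⟨ *-monoˡ-≤ (*-nonNeg (Δ-nonNeg T) (⁻¹-nonNeg 0<ε)) (totalInfluence≤opt T c 0≤c T-computes) ⟩
      (Δ T * ε ⁻¹) * opt f c
        ≈⟨ *-comm _ (opt f c) ⟩
      opt f c * (Δ T * ε ⁻¹) ∎
      where
      influence-cong : ∀ i → influence i (eval T) ≈ influence i f
      influence-cong i = 𝔼-cong λ x →
        reflexive (≡.cong₂ mismatch (T-computes (x [ i ]≔ false)) (T-computes (x [ i ]≔ true)))

  module _ {β : Carrier} (0<β : 0# < β) (c : Vector Carrier n) (0≤c : ∀ i → 0# ≤ c i)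
           (T : DecisionTree n) where

    follower-halts : ∀ x → Halts β c x (follower T)
    -- Starting from zero, `k i` investments of `β` reach `c i`; the fuel is inferred to be the sum
    -- of these counts.
    follower-halts x = run T _ k ≡.refl λ i →
      ≤-trans (proj₂ (archimedean (c i) 0<β)) (≤-reflexive (sym (+-identityˡ _)))
      where
      k : Vector ℕ _
      k i = proj₁ (archimedean (c i) 0<β)

    follower-cost : (𝔼 λ x → runCost (follower-halts x)) ≤
                    n · β + sum (λ i → c i * ℙ-queried T i)
    follower-cost = begin
      𝔼 (λ x → runCost (follower-halts x))
        ≤⟨ 𝔼-mono (λ x → runCost≤price T (follower-halts x) (0≤price x)) ⟩
      𝔼 (λ x → sum λ i → β + c i * 𝟙 (lookup (queried T x) i))
        ≈⟨ 𝔼-sum (λ i x → β + c i * 𝟙 (lookup (queried T x) i)) ⟩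
      sum (λ i → 𝔼 λ x → β + c i * 𝟙 (lookup (queried T x) i))
        ≈⟨ sum-cong-≋ (λ i → trans (𝔼-+ (λ _ → β) (λ x → c i * 𝟙 (lookup (queried T x) i)))
             (+-cong (𝔼-const n β) (𝔼-* (c i) (λ x → 𝟙 (lookup (queried T x) i))))) ⟩
      sum (λ i → β + c i * ℙ-queried T i)
        ≈⟨ ∑-distrib-+ (λ _ → β) (λ i → c i * ℙ-queried T i) ⟩
      sum {n} (λ _ → β) + sum (λ i → c i * ℙ-queried T i)
        ≈⟨ +-congʳ (sum-replicate n) ⟩
      n · β + sum (λ i → c i * ℙ-queried T i) ∎
      where
      -- The invariant at the start of the run, where nothing has been invested.
      0≤price : ∀ x i → 0# ≤ price T {β} {c} {x} i
      0≤price x i = +-nonNeg (proj₁ 0<β) (*-nonNeg (0≤c i) (0≤𝟙 (lookup (queried T x) i)))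

  -- The algorithm is deterministic: its error probability comes from the uniform input alone. It is
  -- built from `ε` and `T` without access to the costs.
  followPruned : Carrier → DecisionTree n → Randomised (Online n)
  followPruned ε T = pointMass (follower (pruned ε T))

  module _ {β : Carrier} (0<β : 0# < β) {f : Vec Bool n → Bool}
           (c : Vector Carrier n) (0≤c : ∀ i → 0# ≤ c i) {ε : Carrier} (0<ε : 0# < ε)
           (T : DecisionTree n) (T-readOnce : ReadOnce T) (T-computes : Computes T f) where

    private
      P : DecisionTree n
      P = pruned ε T

    followPruned-halts : AlwaysHalts (followPruned ε T) β c
    followPruned-halts _ = follower-halts 0<β c 0≤c P

    followPruned-error : onlineError (followPruned ε T) followPruned-halts f ≤ ε
    followPruned-error = begin
      onlineError (followPruned ε T) followPruned-halts f
        ≈⟨ average-pointMass (follower P) _ ⟩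
      𝔼 (λ x → mismatch (result (follower-halts 0<β c 0≤c P x)) (f x))
        ≈⟨ 𝔼-cong (λ x → reflexive (≡.cong₂ mismatch
             (result-correct P (follower-halts 0<β c 0≤c P x)) (≡.sym (T-computes x)))) ⟩
      err P (eval T)
        ≤⟨ pruned-err 0<ε T T-readOnce ⟩
      ε ∎

    followPruned-cost : onlineCost (followPruned ε T) followPruned-halts ≤
                        n · β + opt f c * (Δ T * ε ⁻¹)
    followPruned-cost = begin
      onlineCost (followPruned ε T) followPruned-halts
        ≈⟨ average-pointMass (follower P) _ ⟩
      𝔼 (λ x → runCost (follower-halts 0<β c 0≤c P x))
        ≤⟨ follower-cost 0<β c 0≤c P ⟩
      n · β + sum (λ i → c i * ℙ-queried P i)
        ≤⟨ +-monoʳ-≤ (n · β) (pruned-price 0<ε T c 0≤c T-readOnce T-computes) ⟩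
      n · β + opt f c * (Δ T * ε ⁻¹) ∎

mainTheorem10 : (ℝ : RealNumbers) →
    let open RealNumbers ℝ
        open PricedQuery ℝ
    in
    (n : ℕ) (β : Carrier) → 0# < β →
    Σ[ A ∈ (Carrier → DecisionTree n → Randomised (Online n)) ]
      ((f : Vec Bool n → Bool) (c : Vector Carrier n) (ε : Carrier) (T : DecisionTree n) →
       (∀ i → 0# ≤ c i) → 0# < ε → ε ≤ 1# → ReadOnce T → Computes T f →
       Σ[ runs ∈ AlwaysHalts (A ε T) β c ]
         (onlineError (A ε T) runs f ≤ ε ×
          onlineCost (A ε T) runs ≤ (n · β) + (opt f c * (Δ T * ε ⁻¹))))
mainTheorem10 ℝ n β 0<β = followPruned ,
  λ f c ε T 0≤c 0<ε _ T-readOnce T-computes →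
    followPruned-halts 0<β c 0≤c 0<ε T T-readOnce T-computes ,
    followPruned-error 0<β c 0≤c 0<ε T T-readOnce T-computes ,
    followPruned-cost 0<β c 0≤c 0<ε T T-readOnce T-computes
  where open OrderedField ℝ
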